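{- Let $G$ be a $2$-connected graph of order at least three. If $\max\{d_G(x), d_G(y)\}\geq \widetilde{\alpha}(G)$ for any nonadjacent vertices $x$ and $y$ with $d_G(x,y)=2$, then $G$ is hamiltonian.
   Context: All graphs are finite and simple. $d_G(v)$ denotes the degree of a vertex $v$ in $G$, and $d_G(x,y)$ denotes the distance between $x$ and $y$ in $G$. The bipartite independence number $\widetilde{\alpha}(G)$ of a graph $G$ is the smallest integer $q$ for which there exist positive integers $s$ and $t$ with $s+t=q+1$ such that for any two disjoint subsets $A,B\subseteq V(G)$ with $|A|=s$ and $|B|=t$, there is an edge of $G$ with one endpoint in $A$ and the other in $B$. A graph is hamiltonian if it contains a cycle through all its vertices. -}

module Defs where

open import Data.Nat using (ℕ; zero; suc; _+_; _∸_; _≤_; _<_; _⊔_; _%_)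
open import Data.Bool using (Bool; true; false; if_then_else_)
open import Data.Fin using (Fin; toℕ)
open import Data.Fin.Subset using (Subset; _∈_; _∉_; ∣_∣)
open import Data.List using (List; map; allFin)
open import Data.Nat.ListAction using (sum)
open import Data.Product using (Σ; _×_; _,_; ∃; ∃-syntax)
open import Data.Sum using (_⊎_)
open import Data.Unit using (⊤)
open import Relation.Nullary using (¬_)
open import Relation.Binary.PropositionalEquality using (_≡_; _≢_)
open import Function.Definitions using (Injective)

record Graph : Set where
  field
    n       : ℕ
    adj     : Fin n → Fin n → Bool
    adj-sym : ∀ x y → adj x y ≡ adj y x
    loopless : ∀ x → adj x x ≡ false

open Graph public

Adj : (G : Graph) → Fin (n G) → Fin (n G) → Set
Adj G x y = adj G x y ≡ true

degree : (G : Graph) → Fin (n G) → ℕ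
degree G x = sum (map (λ y → if adj G x y then 1 else 0) (allFin (n G)))

data Walk (G : Graph) : Fin (n G) → Fin (n G) → ℕ → Set where
  nil  : ∀ x → Walk G x x 0
  cons : ∀ {x y z k} → Adj G x y → Walk G y z k → Walk G x z (suc k)

Dist : (G : Graph) → Fin (n G) → Fin (n G) → ℕ → Set
Dist G x y k = Walk G x y k × (∀ m → m < k → ¬ Walk G x y m)

data Reach (G : Graph) (ok : Fin (n G) → Set) : Fin (n G) → Fin (n G) → Set where
  here : ∀ {x} → ok x → Reach G ok x x
  step : ∀ {x y z} → ok x → Adj G x y → Reach G ok y z → Reach G ok x z

Connected : Graph → Set
Connected G = ∀ x y → Reach G (λ _ → ⊤) x y

TwoConnected : Graph → Set
TwoConnected G =
  (3 ≤ n G) × Connected G ×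
  (∀ v x y → x ≢ v → y ≢ v → Reach G (λ w → w ≢ v) x y)

EdgeBetween : (G : Graph) → Subset (n G) → Subset (n G) → Set
EdgeBetween G A B = ∃[ a ] ∃[ b ] (a ∈ A × b ∈ B × Adj G a b)

Disjoint : ∀ {m} → Subset m → Subset m → Set
Disjoint A B = ∀ x → x ∈ A → x ∉ B

BipProp : Graph → ℕ → Set
BipProp G q = ∃[ s ] ∃[ t ] (1 ≤ s × 1 ≤ t × s + t ≡ q + 1 ×
  (∀ (A B : Subset (n G)) → Disjoint A B → ∣ A ∣ ≡ s → ∣ B ∣ ≡ t →
     EdgeBetween G A B))

IsBipIndepNumber : Graph → ℕ → Set
IsBipIndepNumber G q = BipProp G q × (∀ q' → BipProp G q' → q ≤ q')

Hamiltonian : Graph → Set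
Hamiltonian G = Σ (Fin (n G) → Fin (n G)) λ σ → (Injective _≡_ _≡_ σ ×
  (∀ i j → (toℕ j ≡ suc (toℕ i) ⊎ (toℕ i ≡ n G ∸ 1 × toℕ j ≡ 0)) →
     Adj G (σ i) (σ j)))

{-# OPTIONS --safe #-}

-- Call a vertex heavy if its degree is at least q. Every path either can be lengthened or its vertex
-- set carries a cycle; a non-spanning cycle gives a longer path by connectivity, so lengthening ends
-- with a Hamilton cycle. For the dichotomy, rotate the path at each end until that end is heavy: two
-- nonadjacent light vertices have no common neighbour, so if no rotation produces a heavy end then
-- the rotated light vertices close up to a cycle or are separated from the rest by a single vertex.
-- When both ends x and y are heavy, cut the path just before the s-th neighbour of x. Either y has t
-- neighbours after the cut, or it has s of them before the cut while x has at least t after it. Both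
-- times, shifting these neighbours by one along the path yields disjoint sets of sizes s and t, and
-- an edge between them closes the path to a cycle.
module Submission where

open import Defs
open import Data.Nat using (ℕ; zero; suc; _+_; _∸_; _≤_; _<_; _⊔_; z≤n; s≤s; _≤?_)
open import Data.Nat.Properties hiding (_≟_; _≤?_)
open import Data.Nat.ListAction using (sum)
open import Data.Nat.ListAction.Properties using (sum-↭; sum-++)
open import Data.Bool using (true; false; if_then_else_)
open import Data.Bool.Properties using () renaming (_≟_ to _≟ᵇ_)
open import Data.Fin using (Fin; zero; suc; toℕ; cast; fromℕ<; _≟_)
open import Data.Fin.Properties using (any?; toℕ-cast; toℕ-injective)
open import Data.Fin.Subset as Subset using (Subset; inside; outside; ⁅_⁆; _∪_; ∣_∣)
import Data.Fin.Subset.Properties as Subset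
open import Data.List using (List; []; _∷_; [_]; _++_; map; length; take; lookup)
open import Data.List.Properties using (length-take; map-++)
open import Data.List.Membership.DecPropositional using (_∈?_)
open import Data.List.Membership.Propositional using (_∈_; _∉_)
open import Data.List.Membership.Propositional.Properties
  using (∈-∃++; ∈-++⁺ˡ; ∈-++⁻; ∈-lookup)
open import Data.List.Relation.Binary.Permutation.Propositional
  using (_↭_; ↭-refl; ↭-sym; ↭-trans; ↭-reflexive; ↭⇒↭ₛ; prep)
open import Data.List.Relation.Binary.Permutation.Propositional.Properties
  using (∈-resp-↭; map⁺; shift; ++-comm; ++⁺; ++⁺ˡ; ++-commutativeMonoid)
import Data.List.Relation.Binary.Permutation.Setoid.Properties as Permutation
open import Data.List.Relation.Unary.All as All using (All; []; _∷_)
import Data.List.Relation.Unary.All.Properties as All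
import Data.Vec
open import Data.List.Relation.Unary.AllPairs using ([]; _∷_)
open import Data.List.Relation.Unary.Any using (here; there)
open import Data.List.Relation.Unary.Unique.Propositional using (Unique)
open import Data.List.Relation.Unary.Unique.Propositional.Properties
  using (take⁺; allFin⁺; Unique[x∷xs]⇒x∉xs)
import Algebra.Solver.CommutativeMonoid as CommutativeMonoidSolver
open import Data.Product using (_×_; _,_; ∃-syntax; proj₁; proj₂)
open import Data.Sum using (_⊎_; inj₁; inj₂)
open import Function using (_∘_; case_of_)
open import Relation.Nullary using (¬_; yes; no; ¬?; contradiction)
open import Relation.Nullary.Decidable using (decidable-stable; _×-dec_)
open import Relation.Binary.PropositionalEquality
  using (_≡_; _≢_; refl; sym; trans; cong; cong₂; subst; setoid; module ≡-Reasoning)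

private variable
  A : Set
  m : ℕ

-- Lists without repetition and finite subsets.

Unique-resp-↭ : {xs ys : List A} → xs ↭ ys → Unique xs → Unique ys
Unique-resp-↭ p = Permutation.Unique-resp-↭ (setoid _) (↭⇒↭ₛ p)

Unique-++⁻ˡ : ∀ (xs {ys} : List A) → Unique (xs ++ ys) → Unique xs
Unique-++⁻ˡ []       _         = []
Unique-++⁻ˡ (x ∷ xs) (x≢ ∷ uq) = All.++⁻ˡ xs x≢ ∷ Unique-++⁻ˡ xs uq

Unique-++⁻ʳ : ∀ (xs {ys} : List A) → Unique (xs ++ ys) → Unique ys
Unique-++⁻ʳ []       uq       = uq
Unique-++⁻ʳ (x ∷ xs) (_ ∷ uq) = Unique-++⁻ʳ xs uq

Unique-++⇒∉ : ∀ {xs ys : List A} {v} → Unique (xs ++ ys) → v ∈ xs → v ∉ ys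
Unique-++⇒∉ {xs = x ∷ xs} (x≢ ∷ _)  (here refl) v∈ys = All.lookup (All.++⁻ʳ xs x≢) v∈ys refl
Unique-++⇒∉ {xs = x ∷ xs} (_  ∷ uq) (there v∈xs)     = Unique-++⇒∉ uq v∈xs

∉⇒Unique-∷ : ∀ {xs : List A} {v} → v ∉ xs → Unique xs → Unique (v ∷ xs)
∉⇒Unique-∷ v∉ uq = All.¬Any⇒All¬ _ v∉ ∷ uq

lookup-injective : ∀ {xs : List A} → Unique xs → ∀ i j → lookup xs i ≡ lookup xs j → i ≡ j
lookup-injective (x≢ ∷ uq) zero    zero    _  = refl
lookup-injective (x≢ ∷ uq) zero    (suc j) eq = contradiction eq (All.lookup x≢ (∈-lookup j))
lookup-injective (x≢ ∷ uq) (suc i) zero    eq = contradiction (sym eq) (All.lookup x≢ (∈-lookup i))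
lookup-injective (x≢ ∷ uq) (suc i) (suc j) eq = cong suc (lookup-injective uq i j eq)

take-⊆ : ∀ k {xs : List A} {v} → v ∈ take k xs → v ∈ xs
take-⊆ (suc k) {x ∷ xs} (here eq)  = here eq
take-⊆ (suc k) {x ∷ xs} (there v∈) = there (take-⊆ k v∈)

toSubset : List (Fin m) → Subset m
toSubset []       = Subset.⊥
toSubset (x ∷ xs) = ⁅ x ⁆ ∪ toSubset xs

∈-toSubset⁻ : ∀ (xs : List (Fin m)) {v} → v Subset.∈ toSubset xs → v ∈ xs
∈-toSubset⁻ []       v∈ = contradiction v∈ Subset.∉⊥
∈-toSubset⁻ (x ∷ xs) v∈ with Subset.x∈p∪q⁻ ⁅ x ⁆ (toSubset xs) v∈
... | inj₁ v∈x  = here (Subset.x∈⁅y⁆⇒x≡y x v∈x)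
... | inj₂ v∈xs = there (∈-toSubset⁻ xs v∈xs)

∈-toSubset⁺ : ∀ {xs : List (Fin m)} {v} → v ∈ xs → v Subset.∈ toSubset xs
∈-toSubset⁺ (here refl) = Subset.x∈p∪q⁺ (inj₁ (Subset.x∈⁅x⁆ _))
∈-toSubset⁺ (there v∈)  = Subset.x∈p∪q⁺ (inj₂ (∈-toSubset⁺ v∈))

∣⁅x⁆∪p∣ : ∀ (x : Fin m) p → x Subset.∉ p → ∣ ⁅ x ⁆ ∪ p ∣ ≡ suc ∣ p ∣
∣⁅x⁆∪p∣ zero    (inside  Data.Vec.∷ p) x∉ = contradiction Data.Vec.here x∉
∣⁅x⁆∪p∣ zero    (outside Data.Vec.∷ p) x∉ = cong (suc ∘ ∣_∣) (Subset.∪-identityˡ p)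
∣⁅x⁆∪p∣ (suc x) (inside  Data.Vec.∷ p) x∉ = cong suc (∣⁅x⁆∪p∣ x p (x∉ ∘ Data.Vec.there))
∣⁅x⁆∪p∣ (suc x) (outside Data.Vec.∷ p) x∉ = ∣⁅x⁆∪p∣ x p (x∉ ∘ Data.Vec.there)

∣toSubset∣ : ∀ {xs : List (Fin m)} → Unique xs → ∣ toSubset xs ∣ ≡ length xs
∣toSubset∣ {m} {[]} [] = Subset.∣⊥∣≡0 m
∣toSubset∣ {m} {x ∷ xs} uq@(_ ∷ uq′) = trans
  (∣⁅x⁆∪p∣ x (toSubset xs) (Unique[x∷xs]⇒x∉xs uq ∘ ∈-toSubset⁻ xs))
  (cong suc (∣toSubset∣ uq′))

Unique⇒length≤ : ∀ {xs : List (Fin m)} → Unique xs → length xs ≤ m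
Unique⇒length≤ {xs = xs} uq = subst (_≤ _) (∣toSubset∣ uq) (Subset.∣p∣≤n (toSubset xs))

Unique-full⇒length≡ : ∀ {xs : List (Fin m)} → Unique xs → (∀ v → v ∈ xs) → length xs ≡ m
Unique-full⇒length≡ {m} {xs} uq full = begin
  length xs          ≡⟨ ∣toSubset∣ uq ⟨
  ∣ toSubset xs ∣    ≡⟨ cong ∣_∣ (Subset.⊆-antisym Subset.⊆⊤ λ {v} _ → ∈-toSubset⁺ (full v)) ⟩
  ∣ Subset.⊤ {m} ∣   ≡⟨ Subset.∣⊤∣≡n m ⟩
  m                  ∎
  where open ≡-Reasoning

-- Paths and cycles as vertex lists up to permutation.

module Chains (G : Graph) where

  V : Set
  V = Fin (n G)

  infix 4 _~_
  _~_ : V → V → Set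
  _~_ = Adj G

  ~-sym : ∀ {x y} → x ~ y → y ~ x
  ~-sym {x} {y} x~y = trans (adj-sym G y x) x~y

  data Chain : V → List V → V → Set where
    end  : ∀ {a} → Chain a [ a ] a
    link : ∀ {a b c xs} → a ~ b → Chain b xs c → Chain a (a ∷ xs) c

  private variable
    a b c d u v w x y z : V
    L L₁ L₂ S T : List V

  start∈ : Chain a L b → a ∈ L
  start∈ end        = here refl
  start∈ (link _ _) = here refl

  end∈ : Chain a L b → b ∈ L
  end∈ end        = here refl
  end∈ (link _ c) = there (end∈ c)

  join : Chain a L₁ b → b ~ c → Chain c L₂ d → Chain a (L₁ ++ L₂) d
  join end        e c₂ = link e c₂
  join (link f c) e c₂ = link f (join c e c₂)

  -- `S` matters only up to permutation, so a rotated path is again a path on the same `S`.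
  Path : V → List V → V → Set
  Path a S b = ∃[ L ] Chain a L b × L ↭ S

  -- Two adjacent vertices also qualify. This is harmless: a Hamilton cycle is read off only from a
  -- spanning `S`, which has at least three vertices.
  Cyclic : List V → Set
  Cyclic S = ∃[ a ] ∃[ b ] Path a S b × b ~ a

  chain⇒path : Chain a L b → Path a L b
  chain⇒path c = _ , c , ↭-refl

  path-resp : S ↭ T → Path a S b → Path a T b
  path-resp p (L , c , q) = L , c , ↭-trans q p

  cyclic-resp : S ↭ T → Cyclic S → Cyclic T
  cyclic-resp p (a , b , P , e) = a , b , path-resp p P , e

  infixr 5 _—⟨_⟩—_
  _—⟨_⟩—_ : Path a S b → b ~ c → Path c T d → Path a (S ++ T) d
  (_ , c₁ , p) —⟨ e ⟩— (_ , c₂ , q) = _ , join c₁ e c₂ , ++⁺ p q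

  chain-reverse : Chain a L b → Path b L a
  chain-reverse end                       = chain⇒path end
  chain-reverse (link {a} {xs = L} e c) =
    path-resp (++-comm L [ a ]) (chain-reverse c —⟨ ~-sym e ⟩— chain⇒path end)

  path-reverse : Path a S b → Path b S a
  path-reverse (_ , c , p) = path-resp p (chain-reverse c)

  path-unique : (P : Path a S b) → Unique S → Unique (proj₁ P)
  path-unique (_ , _ , p) = Unique-resp-↭ (↭-sym p)

  chain-from : Chain a L b → c ∈ L →
    c ≡ a ⊎ ∃[ u ] ∃[ L₁ ] ∃[ L₂ ] Chain a L₁ u × u ~ c × Chain c L₂ b × L ≡ L₁ ++ L₂
  chain-from end        (here refl) = inj₁ refl
  chain-from (link e c) (here refl) = inj₁ refl
  chain-from (link e c) (there c∈) with chain-from c c∈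
  ... | inj₁ refl = inj₂ (_ , _ , _ , end , e , c , refl)
  ... | inj₂ (u , L₁ , L₂ , c₁ , f , c₂ , refl) = inj₂ (u , _ , L₂ , link e c₁ , f , c₂ , refl)

  cyclic⇒path-from : Cyclic S → v ∈ S → ∃[ b ] Path v S b
  cyclic⇒path-from (a , b , (L , c , p) , e) v∈ with chain-from c (∈-resp-↭ (↭-sym p) v∈)
  ... | inj₁ refl = b , L , c , p
  ... | inj₂ (u , L₁ , L₂ , c₁ , f , c₂ , refl) = u , L₂ ++ L₁ , join c₂ e c₁ , ↭-trans (++-comm L₂ L₁) p

  -- Neighbours on a path and their predecessors.

  nbrs : V → List V → ℕ
  nbrs x L = sum (map (λ y → if adj G x y then 1 else 0) L)

  nbrs-↭ : S ↭ T → nbrs x S ≡ nbrs x T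
  nbrs-↭ p = sum-↭ (map⁺ _ p)

  nbrs-++ : ∀ x L₁ L₂ → nbrs x (L₁ ++ L₂) ≡ nbrs x L₁ + nbrs x L₂
  nbrs-++ x L₁ L₂ = trans (cong sum (map-++ _ L₁ L₂)) (sum-++ (map _ L₁) _)

  -- Each counted vertex is deleted from `T` once it is found there; as `S` has no repetitions, the
  -- later neighbours of `x` survive the deletion.
  nbrs-mono : Unique S → (∀ {z} → z ∈ S → x ~ z → z ∈ T) → nbrs x S ≤ nbrs x T
  nbrs-mono {[]}    _  _ = z≤n
  nbrs-mono {s ∷ S} {x} {T} uq@(s≢ ∷ uq′) S⊆T with adj G x s in eq
  ... | false = nbrs-mono uq′ (S⊆T ∘ there)
  ... | true with ∈-∃++ (S⊆T (here refl) eq)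
  ...   | T₁ , T₂ , refl = ≤-trans (s≤s (nbrs-mono uq′ S⊆T′))
            (≤-reflexive (sym (trans (nbrs-↭ (shift s T₁ T₂))
              (cong (λ e → (if e then 1 else 0) + nbrs x (T₁ ++ T₂)) eq))))
    where
    S⊆T′ : ∀ {z} → z ∈ S → x ~ z → z ∈ T₁ ++ T₂
    S⊆T′ z∈ x~z with ∈-resp-↭ (shift s T₁ T₂) (S⊆T (there z∈) x~z)
    ... | here refl = contradiction z∈ (Unique[x∷xs]⇒x∉xs uq)
    ... | there z∈T = z∈T

  degree≤nbrs : (∀ {z} → x ~ z → z ∈ S) → degree G x ≤ nbrs x S
  degree≤nbrs N⊆S = nbrs-mono (allFin⁺ (n G)) (λ _ → N⊆S)

  -- These are the neighbours of `x` shifted by one towards the start. A neighbour at the first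
  -- vertex has no predecessor, whence the extra summand in `nbrs-chain`.
  preds : V → Chain a L b → List V
  preds x end                    = []
  preds x (link {a} {b} _ c) = if adj G x b then a ∷ preds x c else preds x c

  nbrs-chain : ∀ x (c : Chain a L b) → nbrs x L ≡ (if adj G x a then 1 else 0) + length (preds x c)
  nbrs-chain x end = refl
  nbrs-chain x (link {a} {b} _ c) = cong ((if adj G x a then 1 else 0) +_)
    (trans (nbrs-chain x c) lemma)
    where
    lemma : (if adj G x b then 1 else 0) + length (preds x c)
          ≡ length (if adj G x b then a ∷ preds x c else preds x c)
    lemma with adj G x b
    ... | true  = refl
    ... | false = refl

  ∈-preds⁻ : ∀ x (c : Chain a L b) → v ∈ preds x c →
    ∃[ w ] ∃[ L₁ ] ∃[ L₂ ] Chain a L₁ v × v ~ w × Chain w L₂ b × x ~ w × L ≡ L₁ ++ L₂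
  ∈-preds⁻ x (link {a} {b} e c) v∈ with adj G x b in eq
  ∈-preds⁻ x (link {a} {b} e c) (here refl) | true = b , _ , _ , end , e , c , eq , refl
  ∈-preds⁻ x (link {a} {b} e c) (there v∈)  | true with ∈-preds⁻ x c v∈
  ... | w , L₁ , L₂ , c₁ , f , c₂ , x~w , refl = w , _ , _ , link e c₁ , f , c₂ , x~w , refl
  ∈-preds⁻ x (link {a} {b} e c) v∈ | false with ∈-preds⁻ x c v∈
  ... | w , L₁ , L₂ , c₁ , f , c₂ , x~w , refl = w , _ , _ , link e c₁ , f , c₂ , x~w , refl

  preds⊆ : ∀ x (c : Chain a L b) → v ∈ preds x c → v ∈ L
  preds⊆ x c v∈ with ∈-preds⁻ x c v∈
  ... | _ , _ , _ , c₁ , _ , _ , _ , refl = ∈-++⁺ˡ (end∈ c₁)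

  end∉preds : ∀ x (c : Chain a L b) → Unique L → b ∉ preds x c
  end∉preds x c uq b∈ with ∈-preds⁻ x c b∈
  ... | _ , _ , _ , c₁ , _ , c₂ , _ , refl = Unique-++⇒∉ uq (end∈ c₁) (end∈ c₂)

  preds-unique : ∀ x (c : Chain a L b) → Unique L → Unique (preds x c)
  preds-unique x end _ = []
  preds-unique x (link {a} {b} e c) uq@(_ ∷ uq′) with adj G x b
  ... | true  = ∉⇒Unique-∷ (Unique[x∷xs]⇒x∉xs uq ∘ preds⊆ x c) (preds-unique x c uq′)
  ... | false = preds-unique x c uq′

  -- The successor in `total-count` stands for `p`: it precedes the neighbour `s` of `x`, but the
  -- edge from `p` to `s` lies in neither part.
  record Cut (x : V) (a : V) (L : List V) (b : V) (k total : ℕ) : Set where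
    constructor cut
    field
      {p s}        : V
      {front back} : List V
      left         : Chain a front p
      edge         : p ~ s
      right        : Chain s back b
      split        : L ≡ front ++ back
      x~s          : x ~ s
      left-count   : length (preds x left) ≡ k
      total-count  : total ≡ suc (k + length (preds x right))

  cut-at : ∀ x (c : Chain a L b) k → k < length (preds x c) → Cut x a L b k (length (preds x c))
  cut-at x (link {a} {b} e c) k k< with adj G x b in eq
  cut-at x (link {a} {b} e c) zero    k<       | true = cut end e c refl eq refl refl
  cut-at x (link {a} {b} e c) (suc k) (s≤s k<) | true with cut-at x c k k<
  ... | cut l f r refl x~w lc tc = cut (link e l) f r refl x~w (lemma lc) (cong suc tc)
    where
    lemma : length (preds x l) ≡ k → length (preds x (link e l)) ≡ suc k
    lemma lc rewrite eq = cong suc lc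
  cut-at x (link {a} {b} e c) k k< | false with cut-at x c k k<
  ... | cut l f r refl x~w lc tc = cut (link e l) f r refl x~w (lemma lc) tc
    where
    lemma : length (preds x l) ≡ k → length (preds x (link e l)) ≡ k
    lemma lc rewrite eq = lc

  -- Lower bounds replace exact sizes, since neighbour counts only give lower bounds; truncating
  -- both lists restores the exact sizes.
  EdgeBetweenLists : ℕ → ℕ → Set
  EdgeBetweenLists s t = ∀ {S T} → Unique S → Unique T → (∀ {v} → v ∈ S → v ∉ T) →
    s ≤ length S → t ≤ length T → ∃[ a ] ∃[ b ] a ∈ S × b ∈ T × a ~ b

  subsets⇒lists : ∀ {s t} →
    (∀ A B → Disjoint A B → ∣ A ∣ ≡ s → ∣ B ∣ ≡ t → EdgeBetween G A B) → EdgeBetweenLists s t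
  subsets⇒lists {s} {t} H {S} {T} uS uT disj s≤ t≤
    with H (toSubset (take s S)) (toSubset (take t T))
           (λ v v∈S v∈T → disj (take-⊆ s (∈-toSubset⁻ _ v∈S)) (take-⊆ t (∈-toSubset⁻ _ v∈T)))
           (card s uS s≤) (card t uT t≤)
    where
    card : ∀ k {L} → Unique L → k ≤ length L → ∣ toSubset (take k L) ∣ ≡ k
    card k {L} uL k≤ = trans (∣toSubset∣ (take⁺ k uL)) (trans (length-take k L) (m≤n⇒m⊓n≡m k≤))
  ... | a , b , a∈ , b∈ , a~b =
    a , b , take-⊆ s (∈-toSubset⁻ _ a∈) , take-⊆ t (∈-toSubset⁻ _ b∈) , a~b

  -- Closing a path both of whose ends have many neighbours on it.

  open CommutativeMonoidSolver (++-commutativeMonoid {A = V}) using (solve; _⊕_; _⊜_)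

  -- The half of the path containing y is traversed from y in exchange-left, so that the vertices
  -- before the neighbours of y there are their successors on the path from x to y.
  module Exchange {x u w y L R} (l : Chain x L u) (u~w : u ~ w) (r : Chain w R y) (x~w : x ~ w) where

    R⁻ = proj₁ (chain-reverse r)
    r⁻ = proj₁ (proj₂ (chain-reverse r))
    R⁻↭R = proj₂ (proj₂ (chain-reverse r))

    -- `u` joins the predecessors because its successor `w` across the cut is adjacent to `x`. If
    -- `a` is `u`, the cycle runs from `x` to `u`, `b` to `y`, `d` to `w`; otherwise from `a` to
    -- `x`, `c` to `u`, `w` to `d`, `y` to `b`.
    exchange-left : a ≡ u ⊎ a ∈ preds x l → b ∈ preds y r⁻ → a ~ b → Cyclic (L ++ R)
    exchange-left {b = b} a∈ b∈ a~b with ∈-preds⁻ y r⁻ b∈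
    ... | d , M₁ , M₂ , m₁ , b~d , m₂ , y~d , eq = result a∈
      where
      M₁M₂↭R : M₁ ++ M₂ ↭ R
      M₁M₂↭R = ↭-trans (↭-reflexive (sym eq)) R⁻↭R
      result : _ → Cyclic (L ++ R)
      result (inj₁ refl) = _ , _ , path-resp (++⁺ˡ L M₁M₂↭R)
        (chain⇒path l —⟨ a~b ⟩— path-reverse (chain⇒path m₁) —⟨ y~d ⟩— chain⇒path m₂) , ~-sym x~w
      result (inj₂ a∈l) with ∈-preds⁻ x l a∈l
      ... | c , L₁ , L₂ , l₁ , a~c , l₂ , x~c , refl = _ , _ , path-resp
        (↭-trans (solve 4 (λ L₁ L₂ M₁ M₂ → L₁ ⊕ L₂ ⊕ M₂ ⊕ M₁ ⊜ (L₁ ⊕ L₂) ⊕ M₁ ⊕ M₂) ↭-refl L₁ L₂ M₁ M₂)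
                 (++⁺ˡ (L₁ ++ L₂) M₁M₂↭R))
        (path-reverse (chain⇒path l₁) —⟨ x~c ⟩— chain⇒path l₂ —⟨ u~w ⟩—
          path-reverse (chain⇒path m₂) —⟨ ~-sym y~d ⟩— chain⇒path m₁) , ~-sym a~b

    -- If `a` is `u`, the cycle runs from `x` to `b`, `u` to `c`, `y` to `w`; otherwise from `x` to
    -- `b`, `a` to `w`, `u` to `c`, `y` to `d`.
    exchange-right : a ≡ u ⊎ a ∈ preds x r → b ∈ preds y l → a ~ b → Cyclic (L ++ R)
    exchange-right {b = b} a∈ b∈ a~b with ∈-preds⁻ y l b∈
    ... | c , L₁ , L₂ , l₁ , b~c , l₂ , y~c , refl = result a∈
      where
      result : _ → Cyclic ((L₁ ++ L₂) ++ R)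
      result (inj₁ refl) = _ , _ , path-resp
        (solve 3 (λ L₁ L₂ R → L₁ ⊕ L₂ ⊕ R ⊜ (L₁ ⊕ L₂) ⊕ R) ↭-refl L₁ L₂ R)
        (chain⇒path l₁ —⟨ ~-sym a~b ⟩— path-reverse (chain⇒path l₂) —⟨ ~-sym y~c ⟩—
          path-reverse (chain⇒path r)) , ~-sym x~w
      result (inj₂ a∈r) with ∈-preds⁻ x r a∈r
      ... | d , R₁ , R₂ , r₁ , a~d , r₂ , x~d , refl = _ , _ , path-resp
        (solve 4 (λ L₁ L₂ R₁ R₂ → L₁ ⊕ R₁ ⊕ L₂ ⊕ R₂ ⊜ (L₁ ⊕ L₂) ⊕ R₁ ⊕ R₂) ↭-refl L₁ L₂ R₁ R₂)
        (chain⇒path l₁ —⟨ ~-sym a~b ⟩— path-reverse (chain⇒path r₁) —⟨ ~-sym u~w ⟩—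
          path-reverse (chain⇒path l₂) —⟨ ~-sym y~c ⟩— path-reverse (chain⇒path r₂)) , ~-sym x~d

  nbrs-chain′ : ∀ x (c : Chain a L b) → adj G x a ≡ false → nbrs x L ≡ length (preds x c)
  nbrs-chain′ x c x≁a = trans (nbrs-chain x c) (cong (λ e → (if e then 1 else 0) + length (preds x c)) x≁a)

  crossing : ∀ {s t} → 1 ≤ s → 1 ≤ t → EdgeBetweenLists s t → (c : Chain x L y) → Unique L →
    s + t ≤ suc (nbrs x L) → s + t ≤ suc (nbrs y L) → Cyclic L
  crossing {x} {L} {y} {suc k} {t} _ 1≤t H c uq (s≤s x-large) (s≤s y-large) with adj G y x in y?x
  ... | true  = _ , _ , chain⇒path c , y?x
  -- As `x` is not adjacent to `y`, no neighbour of `y` is lost at the start of the left part. With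
  -- `k` predecessors on the left, `u` supplies the last of the `s` vertices.
  ... | false = from-cut (cut-at x c k k<)
    where
    x-count : k + t ≤ length (preds x c)
    x-count = ≤-trans x-large (≤-reflexive (nbrs-chain′ x c (loopless G x)))

    k< : k < length (preds x c)
    k< = ≤-trans (≤-trans (≤-reflexive (+-comm 1 k)) (+-monoʳ-≤ k 1≤t)) x-count

    from-cut : Cut x x L y k (length (preds x c)) → Cyclic L
    from-cut (cut {u} {w} {L₁} {L₂} l u~w r refl x~w refl total) = result
      where
      open Exchange l u~w r x~w

      uq₁ : Unique L₁
      uq₁ = Unique-++⁻ˡ L₁ uq

      uq₂ : Unique L₂
      uq₂ = Unique-++⁻ʳ L₁ uq

      y-count : nbrs y (L₁ ++ L₂) ≡ length (preds y l) + length (preds y r⁻)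
      y-count = trans (nbrs-++ y L₁ L₂) (cong₂ _+_ (nbrs-chain′ y l y?x)
        (trans (nbrs-↭ (↭-sym R⁻↭R)) (nbrs-chain′ y r⁻ (loopless G y))))

      left-large : t ≤ length (preds y r⁻) → Cyclic (L₁ ++ L₂)
      left-large t≤ with H
        (∉⇒Unique-∷ (end∉preds x l uq₁) (preds-unique x l uq₁))
        (preds-unique y r⁻ (Unique-resp-↭ (↭-sym R⁻↭R) uq₂))
        (λ v∈ v∈′ → Unique-++⇒∉ uq (∈-left v∈) (∈-resp-↭ R⁻↭R (preds⊆ y r⁻ v∈′)))
        ≤-refl t≤
        where
        ∈-left : v ∈ u ∷ preds x l → v ∈ L₁
        ∈-left (here refl) = end∈ l
        ∈-left (there v∈)  = preds⊆ x l v∈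
      ... | a , b , here refl , b∈ , a~b = exchange-left (inj₁ refl) b∈ a~b
      ... | a , b , there a∈  , b∈ , a~b = exchange-left (inj₂ a∈) b∈ a~b

      right-large : ¬ t ≤ length (preds y r⁻) → Cyclic (L₁ ++ L₂)
      right-large t≰ with H
        (preds-unique y l uq₁)
        (∉⇒Unique-∷ (Unique-++⇒∉ uq (end∈ l) ∘ preds⊆ x r) (preds-unique x r uq₂))
        disjoint
        -- `y` has at least `k + t` neighbours on the path and fewer than `t` of them on the right,
        -- so at least `k + 1` are on the left.
        (+-cancelʳ-≤ t _ _ (≤-trans (s≤s (≤-trans y-large (≤-reflexive y-count)))
          (≤-trans (≤-reflexive (sym (+-suc _ _))) (+-monoʳ-≤ (length (preds y l)) (≰⇒> t≰)))))
        -- Of the at least `k + t` predecessors for `x`, all but `k` remain once `u` is included.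
        (+-cancelˡ-≤ (length (preds x l)) _ _
          (≤-trans x-count (≤-reflexive (trans total (sym (+-suc _ _))))))
        where
        disjoint : v ∈ preds y l → v ∉ u ∷ preds x r
        disjoint v∈ (here refl) = end∉preds y l uq₁ v∈
        disjoint v∈ (there v∈′) = Unique-++⇒∉ uq (preds⊆ y l v∈) (preds⊆ x r v∈′)
      ... | b , a , b∈ , here refl , b~a = exchange-right (inj₁ refl) b∈ (~-sym b~a)
      ... | b , a , b∈ , there a∈  , b~a = exchange-right (inj₂ a∈) b∈ (~-sym b~a)

      result : Cyclic (L₁ ++ L₂)
      result with t ≤? length (preds y r⁻)
      ... | yes t≤ = left-large t≤
      ... | no  t≰ = right-large t≰

  -- Lengthening a path by a vertex outside it.

  _∈V?_ = _∈?_ (_≟_ {n G})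

  Longer : List V → Set
  Longer S = ∃[ z ] ∃[ a ] ∃[ b ] z ∉ S × Path a (z ∷ S) b

  longer-resp : S ↭ T → Longer S → Longer T
  longer-resp p (z , a , b , z∉ , P) = z , a , b , z∉ ∘ ∈-resp-↭ (↭-sym p) , path-resp (prep z p) P

  extend : Path a S b → a ~ z → z ∉ S → Longer S
  extend P a~z z∉ = _ , _ , _ , z∉ , chain⇒path end —⟨ ~-sym a~z ⟩— P

  nbrs⊆⊎longer : Path a S b → Longer S ⊎ (∀ {z} → a ~ z → z ∈ S)
  nbrs⊆⊎longer {a} {S} P with any? (λ z → (adj G a z ≟ᵇ true) ×-dec ¬? (z ∈V? S))
  ... | yes (z , a~z , z∉) = inj₁ (extend P a~z z∉)
  ... | no  ∄z = inj₂ λ {z} a~z → decidable-stable (z ∈V? S) λ z∉ → ∄z (z , a~z , z∉)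

  reach-start : ∀ {ok} → Reach G ok a b → ok a
  reach-start (here ok)     = ok
  reach-start (step ok _ _) = ok

  reach-exit : ∀ {ok} → Reach G ok a b → a ∈ S → b ∉ S →
    ∃[ u ] ∃[ v ] u ∈ S × v ∉ S × u ~ v × ok v
  reach-exit (here _) a∈ a∉ = contradiction a∈ a∉
  reach-exit {S = S} (step {y = y} _ e r) a∈ b∉ with y ∈V? S
  ... | yes y∈ = reach-exit r y∈ b∉
  ... | no  y∉ = _ , y , a∈ , y∉ , e , reach-start r

  -- If `S` misses a vertex, connectivity gives an edge leaving `S`; a path on `S` starting at its
  -- inner end is extended by that edge.
  spanning⊎longer : Connected G → a ∈ S → (∀ {c} → c ∈ S → ∃[ b ] Path c S b) →
    Longer S ⊎ (∀ z → z ∈ S)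
  spanning⊎longer {a} {S} conn a∈ path-from with any? (λ z → ¬? (z ∈V? S))
  ... | no  ∄z       = inj₂ λ z → decidable-stable (z ∈V? S) λ z∉ → ∄z (z , z∉)
  ... | yes (z , z∉) with reach-exit (conn a z) a∈ z∉
  ...   | u , v , u∈ , v∉ , u~v , _ = inj₁ (extend (proj₂ (path-from u∈)) u~v v∉)

  -- From a spanning cyclic list to a Hamilton cycle.

  lookup-first : (c : Chain a L b) → ∀ i → toℕ i ≡ 0 → lookup L i ≡ a
  lookup-first end        zero _ = refl
  lookup-first (link _ _) zero _ = refl

  lookup-last : (c : Chain a L b) → ∀ i → suc (toℕ i) ≡ length L → lookup L i ≡ b
  lookup-last end                   zero    _  = refl
  lookup-last (link _ end)          (suc i) eq = lookup-last end i (suc-injective eq)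
  lookup-last (link _ c@(link _ _)) (suc i) eq = lookup-last c i (suc-injective eq)

  lookup-~ : (c : Chain a L b) → ∀ i j → toℕ j ≡ suc (toℕ i) → lookup L i ~ lookup L j
  lookup-~ end        zero    (suc ()) _
  lookup-~ (link e c) zero    (suc j) eq = subst (_ ~_) (sym (lookup-first c j (suc-injective eq))) e
  lookup-~ (link e c) (suc i) (suc j) eq = lookup-~ c i j (suc-injective eq)

  cyclic⇒hamiltonian : 1 ≤ n G → Unique S → (∀ z → z ∈ S) → Cyclic S → Hamiltonian G
  cyclic⇒hamiltonian 1≤n uS full (a , b , P@(L , c , p) , b~a) = σ , injective , adjacent
    where
    uL : Unique L
    uL = path-unique P uS

    len : n G ≡ length L
    len = sym (Unique-full⇒length≡ uL λ z → ∈-resp-↭ (↭-sym p) (full z))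

    σ : V → V
    σ i = lookup L (cast len i)

    injective : ∀ {i j} → σ i ≡ σ j → i ≡ j
    injective {i} {j} eq = toℕ-injective (trans (sym (toℕ-cast len i))
      (trans (cong toℕ (lookup-injective uL (cast len i) (cast len j) eq)) (toℕ-cast len j)))

    adjacent : ∀ i j → (toℕ j ≡ suc (toℕ i) ⊎ (toℕ i ≡ n G ∸ 1 × toℕ j ≡ 0)) → σ i ~ σ j
    adjacent i j (inj₁ j≡i+1) = lookup-~ c (cast len i) (cast len j)
      (trans (toℕ-cast len j) (trans j≡i+1 (cong suc (sym (toℕ-cast len i)))))
    adjacent i j (inj₂ (i-last , j-first))
      rewrite lookup-first c (cast len j) (trans (toℕ-cast len j) j-first)
            | lookup-last c (cast len i) (trans (cong suc (trans (toℕ-cast len i) i-last))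
                (trans (m+[n∸m]≡n 1≤n) len)) = b~a

  -- Replacing a light end of a path by a heavy one.

  -- If v is light then p, which shares the neighbour z with v, must be heavy.
  FirstNbr : V → V → List V → V → Set
  FirstNbr v a L b = ∃[ p ] ∃[ z ] ∃[ L₁ ] ∃[ L₂ ]
    Chain a L₁ p × p ~ z × Chain z L₂ b × v ~ z × adj G v p ≡ false × L ≡ L₁ ++ L₂

  -- The given `z` only ensures that the search succeeds; the neighbour found is the first on the
  -- chain, so its predecessor is not adjacent to `v`.
  first-nbr : ∀ v → Chain a L b → z ∈ L → v ~ z → v ~ a ⊎ FirstNbr v a L b
  first-nbr v end        (here refl) v~z = inj₁ v~z
  first-nbr v (link e c) (here refl) v~z = inj₁ v~z
  first-nbr v (link {a} e c) (there z∈) v~z with adj G v a in v?a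
  ... | true = inj₁ refl
  ... | false with first-nbr v c z∈ v~z
  ...   | inj₁ v~b = inj₂ (a , _ , _ , _ , end , e , c , v~b , v?a , refl)
  ...   | inj₂ (p , z , L₁ , L₂ , c₁ , f , c₂ , v~z′ , v≁p , refl) =
    inj₂ (p , z , _ , _ , link e c₁ , f , c₂ , v~z′ , v≁p , refl)

  path-length-2⇒dist : x ≢ y → adj G x y ≡ false → x ~ z → z ~ y → Dist G x y 2
  path-length-2⇒dist {x} {y} x≢y x≁y x~z z~y = cons x~z (cons z~y (nil y)) , shorter
    where
    shorter : ∀ k → k < 2 → ¬ Walk G x y k
    shorter 0 _ (nil _)            = x≢y refl
    shorter 1 _ (cons x~y (nil _)) = case trans (sym x~y) x≁y of λ ()
    shorter (suc (suc _)) (s≤s (s≤s ())) _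

  module Fan
    (2-conn : TwoConnected G) (q : ℕ)
    (fan : ∀ x y → adj G x y ≡ false → Dist G x y 2 → q ≤ degree G x ⊔ degree G y)
    where

    Heavy : V → Set
    Heavy v = q ≤ degree G v

    Light : V → Set
    Light v = ¬ Heavy v

    light⇒heavy : Light v → v ≢ x → adj G v x ≡ false → v ~ z → x ~ z → Heavy x
    light⇒heavy {v} {p} light v≢p v≁p v~z p~z
      with fan v p v≁p (path-length-2⇒dist v≢p v≁p v~z (~-sym p~z)) | ⊔-sel (degree G v) (degree G p)
    ... | q≤ | inj₁ eq = contradiction (subst (q ≤_) eq q≤) light
    ... | q≤ | inj₂ eq = subst (q ≤_) eq q≤

    HeavyPath : List V → V → Set
    HeavyPath S y = ∃[ x ] Heavy x × Path x S y

    -- The end `y` stays fixed, so treating one end does not undo what was achieved at the other.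
    Improved : List V → V → Set
    Improved S y = Longer S ⊎ Cyclic S ⊎ HeavyPath S y

    improved-resp : S ↭ T → Improved S y → Improved T y
    improved-resp p (inj₁ l)                    = inj₁ (longer-resp p l)
    improved-resp p (inj₂ (inj₁ c))             = inj₂ (inj₁ (cyclic-resp p c))
    improved-resp p (inj₂ (inj₂ (x , h , P)))   = inj₂ (inj₂ (x , h , path-resp p P))

    -- `K` is the initial block of a path and `w` the vertex after it: any vertex of `K` can be
    -- brought to the front without moving the rest.
    Rotatable : List V → V → Set
    Rotatable K w = ∀ {v} → v ∈ K → ∃[ u ] Path v K u × u ~ w

    -- As w is not a cut vertex, some v in K has a neighbour z outside K and different from w. Rotating
    -- v to the front, the predecessor of z becomes the first vertex of a path with the same end; if
    -- it is never heavy then z may be taken next to w, and w joins the light block K.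
    grow : ∀ {K R} → v ∈ K → (∀ {v} → v ∈ K → Light v) → Rotatable K w → Chain w R y →
      Unique (K ++ R) → Improved (K ++ R) y
    grow v∈ light rot end uq with rot v∈
    -- Only `w` remains outside `K`. Rotating the last vertex `u` to the front gives a path on `K`
    -- with both ends adjacent to `w`.
    ... | u , P , u~w with rot (∈-resp-↭ (proj₂ (proj₂ P)) (end∈ (proj₁ (proj₂ P))))
    ...   | u′ , Q , u′~w = inj₂ (inj₁ (u , _ , Q —⟨ u′~w ⟩— chain⇒path end , ~-sym u~w))
    grow {v₀} {w} {y} {K} {.w ∷ R} v₀∈ light rot (link {b = r} w~r c) uq
      with reach-exit (proj₂ (proj₂ 2-conn) w v₀ r
             (λ { refl → Unique-++⇒∉ uq v₀∈ (here refl) })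
             (λ { refl → Unique[x∷xs]⇒x∉xs (Unique-++⁻ʳ K uq) (start∈ c) }))
             v₀∈ (λ r∈ → Unique-++⇒∉ uq r∈ (there (start∈ c)))
    ... | v , z , v∈ , z∉K , v~z , z≢w with rot v∈ | z ∈V? R
    ...   | u , P , u~w | no z∉R =
      inj₁ (extend (P —⟨ u~w ⟩— chain⇒path (link w~r c)) v~z z∉)
      where
      z∉ : z ∉ K ++ w ∷ R
      z∉ z∈ with ∈-++⁻ K z∈
      ... | inj₁ z∈K         = z∉K z∈K
      ... | inj₂ (here z≡w)  = z≢w z≡w
      ... | inj₂ (there z∈R) = z∉R z∈R
    ...   | u , P , u~w | yes z∈R with first-nbr v c z∈R v~z
    ...     | inj₂ (p , z′ , R₁ , R₂ , c₁ , p~z′ , c₂ , v~z′ , v≁p , refl) =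
      -- The new path runs from `p` back to `r`, through `w`, from `u` back to `v`, then over to
      -- `z′` and on to `y`.
      inj₂ (inj₂ (p , light⇒heavy (light v∈) v≢p v≁p v~z′ p~z′ , path-resp
        (solve 4 (λ R₁ w K R₂ → R₁ ⊕ w ⊕ K ⊕ R₂ ⊜ K ⊕ w ⊕ R₁ ⊕ R₂) ↭-refl R₁ [ w ] K R₂)
        (path-reverse (chain⇒path c₁) —⟨ ~-sym w~r ⟩— chain⇒path end —⟨ ~-sym u~w ⟩—
          path-reverse P —⟨ v~z′ ⟩— chain⇒path c₂)))
      where
      v≢p : v ≢ p
      v≢p refl = Unique-++⇒∉ uq v∈ (there (∈-++⁺ˡ (end∈ c₁)))
    ...     | inj₁ v~r with q ≤? degree G w
    ...       | yes w-heavy = inj₂ (inj₂ (w , w-heavy , path-resp (↭-sym (shift w K R))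
      (chain⇒path end —⟨ ~-sym u~w ⟩— path-reverse P —⟨ v~r ⟩— chain⇒path c)))
    ...       | no  w-light = improved-resp (↭-sym (shift w K R))
      (grow (here refl) light′ rot′ c (Unique-resp-↭ (shift w K R) uq))
      where
      light′ : ∀ {v} → v ∈ w ∷ K → Light v
      light′ (here refl) = w-light
      light′ (there v∈)  = light v∈

      rot′ : Rotatable (w ∷ K) r
      -- `w` comes to the front by reversing the block path, which then ends in `v`, a neighbour of
      -- `r`; the older vertices keep their paths, with `w` appended.
      rot′ (here refl) = v , chain⇒path end —⟨ ~-sym u~w ⟩— path-reverse P , v~r
      rot′ (there v∈)  with rot v∈
      ... | _ , Q , e = w , path-resp (++-comm K [ w ]) (Q —⟨ e ⟩— chain⇒path end) , w~r

    improve : Path x S y → Unique S → Improved S y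
    -- A one-vertex path is not spanning, so connectivity lengthens it.
    improve (_ , end {a} , p) uS
      with spanning⊎longer (proj₁ (proj₂ 2-conn)) (here refl) (λ { (here refl) → a , chain⇒path end ; (there ()) })
    ... | inj₁ longer = inj₁ (longer-resp p longer)
    ... | inj₂ full   = contradiction (subst (3 ≤_) (sym (Unique-full⇒length≡ ([] ∷ []) full)) (proj₁ 2-conn))
                          λ { (s≤s ()) }
    improve P@(_ , link {a} e c , p) uS with q ≤? degree G a
    ... | yes a-heavy = inj₂ (inj₂ (a , a-heavy , P))
    ... | no  a-light = improved-resp p (grow (here refl) (λ { (here refl) → a-light ; (there ()) })
      (λ { (here refl) → a , chain⇒path end , e ; (there ()) }) c (path-unique P uS))

    -- Lengthening until a Hamilton cycle appears.

    module _ {s t} (1≤s : 1 ≤ s) (1≤t : 1 ≤ t) (s+t≡q+1 : s + t ≡ q + 1) (H : EdgeBetweenLists s t) where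

      -- Unless the path can be lengthened, all neighbours of both ends lie on it, so their full
      -- degrees, at least `q`, that is `s + t` less one, are available to `crossing`.
      heavy-ends : Heavy x → Heavy y → Path x S y → Unique S → Longer S ⊎ Cyclic S
      heavy-ends {x} {y} x-heavy y-heavy P@(L , c , p) uS
        with nbrs⊆⊎longer P | nbrs⊆⊎longer (path-reverse P)
      ... | inj₁ longer | _           = inj₁ longer
      ... | inj₂ _      | inj₁ longer = inj₁ longer
      ... | inj₂ Nx     | inj₂ Ny     =
        inj₂ (cyclic-resp p (crossing 1≤s 1≤t H c (path-unique P uS) (large x-heavy Nx) (large y-heavy Ny)))
        where
        large : Heavy v → (∀ {z} → v ~ z → z ∈ _) → s + t ≤ suc (nbrs v L)
        large v-heavy Nv = ≤-trans (≤-reflexive (trans s+t≡q+1 (+-comm q 1)))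
          (s≤s (≤-trans v-heavy (degree≤nbrs (∈-resp-↭ (↭-sym p) ∘ Nv))))

      longer⊎cyclic : Path x S y → Unique S → Longer S ⊎ Cyclic S
      longer⊎cyclic P uS with improve P uS
      ... | inj₁ longer        = inj₁ longer
      ... | inj₂ (inj₁ cyclic) = inj₂ cyclic
      ... | inj₂ (inj₂ (x′ , x-heavy , Q)) with improve (path-reverse Q) uS
      ...   | inj₁ longer                      = inj₁ longer
      ...   | inj₂ (inj₁ cyclic)               = inj₂ cyclic
      ...   | inj₂ (inj₂ (y′ , y-heavy , Q′)) = heavy-ends y-heavy x-heavy Q′ uS

      longer⊎hamiltonian : Path x S y → Unique S → Longer S ⊎ Hamiltonian G
      longer⊎hamiltonian P@(_ , c , p) uS with longer⊎cyclic P uS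
      ... | inj₁ longer = inj₁ longer
      ... | inj₂ cyclic
        with spanning⊎longer (proj₁ (proj₂ 2-conn)) (∈-resp-↭ p (start∈ c)) (cyclic⇒path-from cyclic)
      ...   | inj₁ longer = inj₁ longer
      ...   | inj₂ full   =
        inj₂ (cyclic⇒hamiltonian (≤-trans (s≤s z≤n) (proj₁ 2-conn)) uS full cyclic)

      -- `k` bounds the remaining rounds: it drops as `S` grows, and at zero `S` would have more
      -- than `n G` distinct vertices.
      lengthen : ∀ k → n G < k + length S → Path x S y → Unique S → Hamiltonian G
      lengthen zero    n< P uS = contradiction (Unique⇒length≤ uS) (<⇒≱ n<)
      lengthen (suc k) n< P uS with longer⊎hamiltonian P uS
      ... | inj₂ ham = ham
      ... | inj₁ (z , _ , _ , z∉ , Q) =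
        lengthen k (≤-trans n< (≤-reflexive (sym (+-suc k _)))) Q (∉⇒Unique-∷ z∉ uS)

theorem1p4 : (G : Graph) → TwoConnected G → 3 ≤ n G →
    (q : ℕ) → IsBipIndepNumber G q →
    (∀ x y → adj G x y ≡ false → Dist G x y 2 → q ≤ degree G x ⊔ degree G y) →
    Hamiltonian G
theorem1p4 G 2-conn 3≤n q ((s , t , 1≤s , 1≤t , s+t≡q+1 , H) , _) fan =
  lengthen 1≤s 1≤t s+t≡q+1 (subsets⇒lists H) (suc (n G)) (m≤m+n (suc (n G)) 1)
    (chain⇒path (end {vertex})) ([] ∷ [])
  where
  open Chains G
  open Fan 2-conn q fan

  vertex : V
  vertex = fromℕ< (≤-trans (s≤s z≤n) 3≤n)
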